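{- There exist $2^{\aleph_0}$ path-minimal graphs whose ages are pairwise incomparable with respect to set inclusion and each of which is well-quasi-ordered under embeddability.
   Context: Graphs are undirected, simple and loopless. A graph $H$ embeds in a graph $H'$ if $H$ is isomorphic to an induced subgraph of $H'$. The age $\mathcal{A}(G)$ of a graph $G$ is the collection of finite graphs (up to isomorphism) that embed in $G$, ordered by embeddability; it is well-quasi-ordered (wqo) if it contains no infinite antichain (and no infinite strictly descending chain, which is automatic for finite graphs). A path is a graph $P$ for which there is an injective map $f$ from $V(P)$ into an interval of $\mathbb{Z}$ such that $\{u,v\}\in E(P)$ iff $|f(u)-f(v)|=1$; the length of a finite path is its number of vertices minus one. A graph contains finite induced paths of unbounded length if for every $n$ it has an induced subgraph which is a finite path of length at least $n$. A graph $G$ is path-minimal if it contains finite induced paths of unbounded length and every induced subgraph $G'$ of $G$ with this property embeds $G$. -}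

module Defs where

open import Data.Nat using (ℕ; suc; _≤_)
open import Data.Nat.Properties using (1+n≢n)
open import Data.Fin using (Fin; toℕ)
open import Data.Bool using (Bool)
open import Data.Product using (Σ; _×_; _,_; ∃; proj₁)
open import Data.Sum using (_⊎_; inj₁; inj₂)
open import Relation.Nullary using (¬_)
open import Relation.Binary.PropositionalEquality using (_≡_; _≢_)
open import Function.Bundles using (_↔_)

record Graph : Set₁ where
  field
    V      : Set
    E      : V → V → Set
    sym    : ∀ {u v} → E u v → E v u
    irrefl : ∀ {v} → ¬ E v v
open Graph public

_↪_ : Graph → Graph → Set
H ↪ H' = Σ (V H → V H') λ f →
           (∀ u v → f u ≡ f v → u ≡ v) ×
           (∀ u v → (E H u v → E H' (f u) (f v)) × (E H' (f u) (f v) → E H u v))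

Finite : Graph → Set
Finite H = Σ ℕ λ n → V H ↔ Fin n

Induced : (G : Graph) → (V G → Set) → Graph
Induced G P = record
  { V      = Σ (V G) P
  ; E      = λ u v → E G (proj₁ u) (proj₁ v)
  ; sym    = sym G
  ; irrefl = irrefl G
  }

pathAdj : ∀ {m} → Fin m → Fin m → Set
pathAdj i j = (suc (toℕ i) ≡ toℕ j) ⊎ (suc (toℕ j) ≡ toℕ i)

Path : ℕ → Graph
Path m = record
  { V      = Fin (suc m)
  ; E      = pathAdj
  ; sym    = λ { (inj₁ p) → inj₂ p ; (inj₂ p) → inj₁ p }
  ; irrefl = λ { (inj₁ p) → 1+n≢n p ; (inj₂ p) → 1+n≢n p }
  }

UnboundedPaths : Graph → Set
UnboundedPaths G = ∀ n → Σ ℕ λ m → n ≤ m × (Path m ↪ G)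

PathMinimal : Graph → Set₁
PathMinimal G = UnboundedPaths G ×
  ((P : V G → Set) → UnboundedPaths (Induced G P) → G ↪ Induced G P)

InAge : Graph → Graph → Set
InAge G H = Finite H × (H ↪ G)

AgeSub : Graph → Graph → Set₁
AgeSub G G' = (H : Graph) → InAge G H → InAge G' H

AgeWQO : Graph → Set₁
AgeWQO G = ¬ (Σ (ℕ → Graph) λ s →
              (∀ i → InAge G (s i)) ×
              (∀ i j → i ≢ j → ¬ (s i ↪ s j)))

-- Distinctness of points of the Cantor space (continuum-many indices).
Distinct : (ℕ → Bool) → (ℕ → Bool) → Set
Distinct x y = ¬ (∀ n → x n ≡ y n)

{-# OPTIONS --safe #-}

-- Let u be the Toeplitz word u n = c (v₂ (n + 1)). The graph of u is the sum of
-- the paths 0, …, n − 1 (n ∈ ℕ) labelled by the prefixes of u, where vertices of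
-- distinct paths are adjacent iff both are labelled true. As every second letter of
-- u is true, an induced path with at least seven vertices stays in one component
-- and is an interval of it; as u is uniformly recurrent, long intervals
-- contain every given prefix, whence minimality. Finite induced subgraphs are
-- words over words over factors of u. The factors are well-quasi-ordered because a
-- long factor contains every given one, and Higman's lemma applies twice. A vertex
-- outside a component reads off its labels, so an inclusion of ages makes every
-- prefix of the first word a factor of the second up to reversal, and
-- this determines c when c has no three equal consecutive values.
module Submission where

open import Defs
open import Data.Nat using (ℕ; zero; suc; _+_; _∸_; _*_; _^_; _⊔_; _≤_; _<_; z≤n; s≤s; s≤s⁻¹;
  _≟_; _≤?_; _<?_)
open import Data.Nat.Properties hiding (suc-injective)
import Data.Nat.Properties as ℕ
open import Data.Nat.Tactic.RingSolver using (solve-∀)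
open import Data.Bool using (Bool; true; false; not)
import Data.Bool.Properties as Bool
open import Data.Fin using (Fin; zero; suc; toℕ; fromℕ<)
open import Data.Fin.Properties using (toℕ-fromℕ<; toℕ<n; toℕ-injective; suc-injective; any?)
open import Data.Product using (Σ; Σ-syntax; ∃; ∃-syntax; _×_; _,_; proj₁; proj₂)
open import Data.Sum using (_⊎_; inj₁; inj₂; [_,_]′; map₁; map₂; swap) renaming (map to ⊎-map)
open import Data.Unit using (⊤; tt)
open import Data.Empty using (⊥; ⊥-elim)
open import Data.Maybe using (Maybe; just; nothing; is-just)
open import Data.Maybe.Relation.Binary.Pointwise using (just; nothing) renaming (Pointwise to Pointwiseᴹ)
open import Data.List using (List; []; _∷_; _++_; length; tabulate)
open import Data.List.Relation.Unary.All using (All; []; _∷_)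
open import Data.List.Relation.Binary.Sublist.Heterogeneous using (Sublist; []; _∷_; _∷ʳ_; minimum)
open import Data.List.Relation.Binary.Sublist.Heterogeneous.Properties using (++⁺; sublist?)
open import Relation.Nullary using (¬_; Dec; yes; no; contradiction)
open import Relation.Nullary.Decidable using (recompute; _⊎-dec_; _×-dec_)
open import Relation.Binary.Definitions using (tri<; tri≈; tri>)
open import Relation.Binary.PropositionalEquality
  using (_≡_; _≢_; refl; cong; subst; subst₂; trans; module ≡-Reasoning)
  renaming (sym to ≡-sym)
open import Function using (_∘_; id; _on_)
open import Function.Bundles using (Inverse)
open import Function.Construct.Identity using (↔-id)

-- Almost-full relations and Higman's lemma

-- An inductive form of "every infinite sequence has a good pair": once `x` is played, a later `y`
-- above `x` already counts as success.
data AF {A : Set} (R : A → A → Set) : Set₁ where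
  now   : (∀ x y → R x y) → AF R
  later : (∀ x → AF (λ y z → R y z ⊎ R x y)) → AF R

AF-mono : {A : Set} {R S : A → A → Set} → (∀ {x y} → R x y → S x y) → AF R → AF S
AF-mono R⊆S (now r)   = now λ x y → R⊆S (r x y)
AF-mono R⊆S (later f) = later λ x → AF-mono (⊎-map R⊆S R⊆S) (f x)

AF-on : {A B : Set} {R : B → B → Set} (f : A → B) → AF R → AF (R on f)
AF-on f (now r)   = now λ x y → r (f x) (f y)
AF-on f (later g) = later λ x → AF-on f (g (f x))

AF-good : {A : Set} {R : A → A → Set} → AF R → (s : ℕ → A) →
          ∃[ i ] ∃[ j ] i < j × R (s i) (s j)
AF-good (now r)   s = 0 , 1 , s≤s z≤n , r _ _
AF-good (later f) s with AF-good (f (s 0)) (s ∘ suc)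
... | i , j , i<j , inj₁ r = suc i , suc j , s≤s i<j , r
... | i , j , i<j , inj₂ r = 0 , suc i , s≤s z≤n , r

-- The three "∪-∩" lemmas are Ramsey's theorem for conjunctions depending on
-- zero, one and two points; each reduces to the previous one, with the
-- hypotheses relaxed to inclusions so that the recursion is structural.
∪-∩₀ : {A : Set} {R P Q : A → A → Set} {B C : Set} →
       AF P → (∀ {x y} → P x y → R x y ⊎ B) →
       AF Q → (∀ {x y} → Q x y → R x y ⊎ C) →
       AF (λ x y → R x y ⊎ (B × C))
∪-∩₀ {R = R} {B = B} {C} (now p) P⊆ q Q⊆ = AF-mono step q
  where
  step : ∀ {x y} → _ → R x y ⊎ (B × C)
  step {x} {y} r with P⊆ (p x y)
  ... | inj₁ r′ = inj₁ r′
  ... | inj₂ b  = map₂ (b ,_) (Q⊆ r)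
∪-∩₀ {R = R} {P} {Q} {B} {C} (later f) P⊆ q Q⊆ = later λ x →
  AF-mono (λ { (inj₁ (inj₁ r)) → inj₁ (inj₁ r)
             ; (inj₁ (inj₂ r)) → inj₂ (inj₁ r)
             ; (inj₂ bc)       → inj₁ (inj₂ bc) })
    (∪-∩₀ {R = λ y z → R y z ⊎ R x y} (f x)
       (λ { (inj₁ p) → map₁ inj₁ (P⊆ p) ; (inj₂ p) → map₁ inj₂ (P⊆ p) })
       q (λ r → map₁ inj₁ (Q⊆ r)))

regroup : {X Y Z W : Set} → (X ⊎ Y ⊎ Z) ⊎ W → (X ⊎ Y ⊎ W) ⊎ Z
regroup (inj₁ (inj₁ x))        = inj₁ (inj₁ x)
regroup (inj₁ (inj₂ (inj₁ y))) = inj₁ (inj₂ (inj₁ y))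
regroup (inj₁ (inj₂ (inj₂ z))) = inj₂ z
regroup (inj₂ w)               = inj₁ (inj₂ (inj₂ w))

∪-∩₁ : {A : Set} {R P Q : A → A → Set} {B C : A → Set} →
       AF P → (∀ {x y} → P x y → R x y ⊎ B x) →
       AF Q → (∀ {x y} → Q x y → R x y ⊎ C x) →
       AF (λ x y → R x y ⊎ (B x × C x))
∪-∩₁ {R = R} {B = B} {C} (now p) P⊆ q Q⊆ = AF-mono step q
  where
  step : ∀ {x y} → _ → R x y ⊎ (B x × C x)
  step {x} {y} r with P⊆ (p x y)
  ... | inj₁ r′ = inj₁ r′
  ... | inj₂ b  = map₂ (b ,_) (Q⊆ r)
∪-∩₁ {R = R} {B = B} {C} p@(later _) P⊆ (now q) Q⊆ = AF-mono step p
  where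
  step : ∀ {x y} → _ → R x y ⊎ (B x × C x)
  step {x} {y} r with Q⊆ (q x y)
  ... | inj₁ r′ = inj₁ r′
  ... | inj₂ c  = map₂ (_, c) (P⊆ r)
∪-∩₁ {A} {R} {P} {Q} {B} {C} p@(later f) P⊆ q@(later g) Q⊆ = later λ x →
  AF-mono (λ { (inj₁ (inj₁ r))         → inj₁ (inj₁ r)
             ; (inj₁ (inj₂ (inj₁ r)))  → inj₂ (inj₁ r)
             ; (inj₁ (inj₂ (inj₂ bc))) → inj₁ (inj₂ bc)
             ; (inj₂ bc)               → inj₂ (inj₂ bc) })
    (∪-∩₀ {R = λ y z → R y z ⊎ R x y ⊎ (B y × C y)}
      (∪-∩₁ {R = λ y z → R y z ⊎ R x y ⊎ B x} (f x)
         (λ { (inj₁ r) → map₁ inj₁ (P⊆ r) ; (inj₂ r) → inj₁ (inj₂ (P⊆ r)) })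
         q (λ r → map₁ inj₁ (Q⊆ r)))
      regroup
      (∪-∩₁ {R = λ y z → R y z ⊎ R x y ⊎ C x} p
         (λ r → map₁ inj₁ (P⊆ r))
         (g x) (λ { (inj₁ r) → map₁ inj₁ (Q⊆ r) ; (inj₂ r) → inj₁ (inj₂ (Q⊆ r)) }))
      regroup)

∪-∩₂ : {A : Set} {R P Q B C : A → A → Set} →
       AF P → (∀ {x y} → P x y → R x y ⊎ B x y) →
       AF Q → (∀ {x y} → Q x y → R x y ⊎ C x y) →
       AF (λ x y → R x y ⊎ (B x y × C x y))
∪-∩₂ {R = R} {B = B} {C} (now p) P⊆ q Q⊆ = AF-mono step q
  where
  step : ∀ {x y} → _ → R x y ⊎ (B x y × C x y)
  step {x} {y} r with P⊆ (p x y)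
  ... | inj₁ r′ = inj₁ r′
  ... | inj₂ b  = map₂ (b ,_) (Q⊆ r)
∪-∩₂ {R = R} {B = B} {C} p@(later _) P⊆ (now q) Q⊆ = AF-mono step p
  where
  step : ∀ {x y} → _ → R x y ⊎ (B x y × C x y)
  step {x} {y} r with Q⊆ (q x y)
  ... | inj₁ r′ = inj₁ r′
  ... | inj₂ c  = map₂ (_, c) (P⊆ r)
∪-∩₂ {A} {R} {P} {Q} {B} {C} p@(later f) P⊆ q@(later g) Q⊆ = later λ x →
  AF-mono (λ { (inj₁ (inj₁ r))         → inj₁ (inj₁ r)
             ; (inj₁ (inj₂ (inj₁ r)))  → inj₂ (inj₁ r)
             ; (inj₁ (inj₂ (inj₂ bc))) → inj₁ (inj₂ bc)
             ; (inj₂ bc)               → inj₂ (inj₂ bc) })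
    -- Each recursive call shrinks one of the two trees. With `x` fixed, the leftovers `B x y` and
    -- `C x y` depend on the single point `y`, so `∪-∩₁` joins them.
    (∪-∩₁ {R = λ y z → R y z ⊎ R x y ⊎ (B y z × C y z)}
      (∪-∩₂ {R = λ y z → R y z ⊎ R x y ⊎ B x y} (f x)
         (λ { (inj₁ r) → map₁ inj₁ (P⊆ r) ; (inj₂ r) → inj₁ (inj₂ (P⊆ r)) })
         q (λ r → map₁ inj₁ (Q⊆ r)))
      regroup
      (∪-∩₂ {R = λ y z → R y z ⊎ R x y ⊎ C x y} p
         (λ r → map₁ inj₁ (P⊆ r))
         (g x) (λ { (inj₁ r) → map₁ inj₁ (Q⊆ r) ; (inj₂ r) → inj₁ (inj₂ (Q⊆ r)) }))
      regroup)

AF-∩ : {A : Set} {R S : A → A → Set} → AF R → AF S → AF (λ x y → R x y × S x y)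
AF-∩ {A} r s = AF-mono (λ { (inj₁ ()) ; (inj₂ rs) → rs })
                 (∪-∩₂ {R = λ _ _ → ⊥} r inj₂ s inj₂)

AF-≤ : AF _≤_
AF-≤ = later below
  where
  -- A further point either reaches the bound `suc n`, which is success, or is at most `n`, and then
  -- `below n` takes over.
  below : ∀ n → AF (λ y z → y ≤ z ⊎ n ≤ y)
  below zero    = now λ _ _ → inj₂ z≤n
  below (suc n) = later λ x → step x (suc n ≤? x)
    where
    step : ∀ x → Dec (suc n ≤ x) → AF (λ y z → (y ≤ z ⊎ suc n ≤ y) ⊎ (x ≤ y ⊎ suc n ≤ x))
    step x (yes n<x) = now λ _ _ → inj₂ (inj₂ n<x)
    step x (no n≮x)  = AF-mono
      (λ { (inj₁ y≤z) → inj₁ (inj₁ y≤z)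
         ; (inj₂ n≤y) → inj₂ (inj₁ (≤-trans (≮⇒≥ n≮x) n≤y)) }) (below n)

AF-≡ᴮ : AF (_≡_ {A = Bool})
AF-≡ᴮ = later λ x → later λ w → now λ y z → pigeonhole x w y z
  where
  pigeonhole : (x w y z : Bool) → (y ≡ z ⊎ x ≡ y) ⊎ (w ≡ y ⊎ x ≡ w)
  pigeonhole x w y z with x Bool.≟ w | x Bool.≟ y | w Bool.≟ y
  ... | yes p | _     | _     = inj₂ (inj₂ p)
  ... | no _  | yes q | _     = inj₁ (inj₂ q)
  ... | no _  | no _  | yes r = inj₂ (inj₁ r)
  ... | no p  | no q  | no r  =
    contradiction (trans (Bool.¬-not p) (≡-sym (Bool.¬-not (r ∘ ≡-sym)))) q

AF-Maybe : {A : Set} {R : A → A → Set} → AF R → AF (Pointwiseᴹ R)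
AF-Maybe {A} {R} r = AF-mono (λ {x} {y} → combine x y)
                       (AF-∩ (AF-on is-just AF-≡ᴮ) (lift r))
  where
  -- `Lift` accepts every pair involving `nothing`, so it inherits almost-fullness from the relation
  -- on `A`; comparing the tags then rules out mixed pairs.
  Lift : (A → A → Set) → Maybe A → Maybe A → Set
  Lift S (just x) (just y) = S x y
  Lift S _        _        = ⊤

  Lift-⊎ : ∀ {S a} x y → Lift (λ y z → S y z ⊎ S a y) x y → Lift S x y ⊎ Lift S (just a) x
  Lift-⊎ (just _) (just _) s = s
  Lift-⊎ (just _) nothing  s = inj₁ tt
  Lift-⊎ nothing  _        s = inj₁ tt

  lift : ∀ {S} → AF S → AF (Lift S)
  lift {S} (now s) = now full
    where
    full : ∀ x y → Lift S x y
    full (just x) (just y) = s x y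
    full (just _) nothing  = tt
    full nothing  _        = tt
  lift (later f) = later λ
    { (just a) → AF-mono (λ {x} {y} → Lift-⊎ x y) (lift (f a))
    ; nothing  → now λ _ _ → inj₂ tt }

  combine : ∀ x y → (is-just x ≡ is-just y) × Lift R x y → Pointwiseᴹ R x y
  combine (just _) (just _) (_ , s) = just s
  combine nothing  nothing  _       = nothing

module _ {A : Set} {R : A → A → Set} (R? : ∀ x y → Dec (R x y)) (a : A) where

  data Split : List A → Set where
    none  : ∀ {u} → All (λ x → ¬ R a x) u → Split u
    first : ∀ {u b v} → All (λ x → ¬ R a x) u → R a b → Split (u ++ b ∷ v)

  split : ∀ u → Split u
  split []      = none []
  split (b ∷ u) with R? a b
  ... | yes r = first [] r
  ... | no ¬r with split u
  ...   | none ¬rs     = none (¬r ∷ ¬rs)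
  ...   | first ¬rs r  = first (¬r ∷ ¬rs) r

  pieces : ∀ {u} → Split u → List A × Maybe (A × List A)
  pieces (none {u} _)          = u , nothing
  pieces (first {u} {b} {v} _ _) = u , just (b , v)

  -- No letter of the source is above `a`, so the weaker relation supplied by the subtree at `a`
  -- falls back to `R`.
  avoiding : ∀ {u v} → All (λ x → ¬ R a x) u →
             Sublist (λ y z → R y z ⊎ R a y) u v → Sublist R u v
  avoiding ¬rs        []              = []
  avoiding ¬rs        (y ∷ʳ p)        = y ∷ʳ avoiding ¬rs p
  avoiding (¬r ∷ ¬rs) (inj₁ r ∷ p)    = r ∷ avoiding ¬rs p
  avoiding (¬r ∷ ¬rs) (inj₂ r ∷ p)    = contradiction r ¬r

-- Haines' decomposition: a word avoiding a ∷ w is either a word over the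
-- letters not above a, or such a word followed by a letter and a word avoiding w.
higman : {A : Set} {R : A → A → Set} → (∀ x y → Dec (R x y)) → AF R → AF (Sublist R)
higman {A} {R} R? (now r) = AF-mono (λ {u} {v} → embed u v) (AF-on length AF-≤)
  where
  embed : ∀ u v → length u ≤ length v → Sublist R u v
  embed []      v       _        = minimum v
  embed (x ∷ u) (y ∷ v) (s≤s le) = r x y ∷ embed u v le
higman {A} {R} R? (later f) = later extend
  where
  extend : ∀ w → AF (λ u v → Sublist R u v ⊎ Sublist R w u)
  extend []      = now λ u _ → inj₂ (minimum u)
  extend (a ∷ w) = AF-mono (λ {u} {v} → glue (split R? a u) (split R? a v))
    (AF-on (λ u → pieces R? a (split R? a u))
      -- Induction on the tree handles the part before the first letter above `a`, the given tree
      -- handles that letter, and induction on `w` handles the rest.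
      (AF-∩ (AF-on proj₁ (higman (λ y z → R? y z ⊎-dec R? a y) (f a)))
            (AF-on proj₂ (AF-Maybe (AF-∩ (AF-on proj₁ (later f)) (AF-on proj₂ (extend w)))))))
    where
    glue : ∀ {u v} (p : Split R? a u) (q : Split R? a v) →
           let u₁ , u₂ = pieces R? a p ; v₁ , v₂ = pieces R? a q in
           Sublist (λ y z → R y z ⊎ R a y) u₁ v₁ ×
           Pointwiseᴹ (λ (b , u) (c , v) → R b c × (Sublist R u v ⊎ Sublist R w u)) u₂ v₂ →
           Sublist R u v ⊎ Sublist R (a ∷ w) u
    glue (none ¬rs) (none _) (s , nothing) = inj₁ (avoiding R? a ¬rs s)
    glue (first ¬rs r) (first _ _) (s , just (r′ , inj₁ t)) =
      inj₁ (++⁺ (avoiding R? a ¬rs s) (r′ ∷ t))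
    -- The rest of the word already contains `w`, and the letter above `a` in front of it completes
    -- a copy of `a ∷ w`.
    glue (first ¬rs r) (first _ _) (s , just (_ , inj₂ t)) =
      inj₂ (++⁺ (minimum _) (r ∷ t))

-- Turns a subword embedding into the injection of indices that will carry components to components
-- and runs to runs.
tabulate-embedding : {A : Set} {R : A → A → Set} → ∀ {m n} (f : Fin m → A) (g : Fin n → A) →
  Sublist R (tabulate f) (tabulate g) →
  Σ (Fin m → Fin n) λ σ → (∀ {i j} → σ i ≡ σ j → i ≡ j) × (∀ i → R (f i) (g (σ i)))
tabulate-embedding {m = zero}  f g p = (λ ()) , (λ { {()} }) , λ ()
tabulate-embedding {m = suc m} {suc n} f g (_ ∷ʳ p) with tabulate-embedding f (g ∘ suc) p
... | σ , inj , rel = suc ∘ σ , inj ∘ suc-injective , rel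
tabulate-embedding {m = suc m} {suc n} f g (r ∷ p) with tabulate-embedding (f ∘ suc) (g ∘ suc) p
... | σ , inj , rel = τ , (λ {i} {j} → τ-inj i j) , λ { zero → r ; (suc i) → rel i }
  where
  τ : Fin (suc m) → Fin (suc n)
  τ zero    = zero
  τ (suc i) = suc (σ i)
  τ-inj : ∀ i j → τ i ≡ τ j → i ≡ j
  τ-inj zero    zero    _ = refl
  τ-inj (suc i) (suc j) e = cong suc (inj (suc-injective e))

-- Toeplitz words

-- `inj₁ m` encodes `m + m`, and `inj₂ m` encodes `suc (m + m)`.
half : ℕ → ℕ ⊎ ℕ
half zero    = inj₁ zero
half (suc n) = [ inj₂ , inj₁ ∘ suc ]′ (half n)

half-double : ∀ m → half (m + m) ≡ inj₁ m
half-double zero    = refl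
half-double (suc m) rewrite +-suc m m | half-double m = refl

parity : ∀ n → (∃[ m ] n ≡ m + m) ⊎ (∃[ m ] n ≡ suc (m + m))
parity zero = inj₁ (0 , refl)
parity (suc n) with parity n
... | inj₁ (m , refl) = inj₂ (m , refl)
... | inj₂ (m , refl) = inj₁ (suc m , cong suc (≡-sym (+-suc m m)))

-- Even positions carry `c 0`, and the odd ones carry the word of the shifted sequence. The fuel `n`
-- suffices at position `n`, since `suc (m + m)` leads to `m`.
toeplitz′ : ℕ → (ℕ → Bool) → ℕ → Bool
toeplitz′ zero       c n = c 0
toeplitz′ (suc fuel) c n = [ (λ _ → c 0) , toeplitz′ fuel (c ∘ suc) ]′ (half n)

-- The letter at n is c (v₂ (n + 1)).
toeplitz : (ℕ → Bool) → ℕ → Bool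
toeplitz c n = toeplitz′ n c n

toeplitz′-fuel : ∀ f g c n → n ≤ f → n ≤ g → toeplitz′ f c n ≡ toeplitz′ g c n
toeplitz′-fuel zero    zero    c zero z≤n z≤n = refl
toeplitz′-fuel zero    (suc g) c zero z≤n z≤n = refl
toeplitz′-fuel (suc f) zero    c zero z≤n z≤n = refl
toeplitz′-fuel (suc f) (suc g) c n    n≤f n≤g with parity n
... | inj₁ (m , refl) rewrite half-double m = refl
... | inj₂ (m , refl) rewrite half-double m =
  toeplitz′-fuel f g (c ∘ suc) m (m+n≤o⇒m≤o m (s≤s⁻¹ n≤f)) (m+n≤o⇒m≤o m (s≤s⁻¹ n≤g))

toeplitz-even : ∀ c m → toeplitz c (m + m) ≡ c 0
toeplitz-even c zero = refl
toeplitz-even c (suc m) rewrite +-suc m m | half-double m = refl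

toeplitz-odd : ∀ c m → toeplitz c (suc (m + m)) ≡ toeplitz (c ∘ suc) m
toeplitz-odd c m rewrite half-double m =
  toeplitz′-fuel (m + m) m (c ∘ suc) m (m≤m+n m m) ≤-refl

-- As `0 < suc i < 2 ^ e`, the 2-adic valuation of `suc i` is below `e`, and adding a multiple of
-- `2 ^ e` does not change it.
toeplitz-periodic : ∀ e c q i → suc i < 2 ^ e → toeplitz c (q * 2 ^ e + i) ≡ toeplitz c i
toeplitz-periodic zero    c q i (s≤s ())
toeplitz-periodic (suc e) c q i i<  with parity i
... | inj₁ (m , refl) = begin
  toeplitz c (q * 2 ^ suc e + (m + m))               ≡⟨ cong (toeplitz c) (eq q (2 ^ e) m) ⟩
  toeplitz c ((q * 2 ^ e + m) + (q * 2 ^ e + m))     ≡⟨ toeplitz-even c (q * 2 ^ e + m) ⟩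
  c 0                                                ≡⟨ toeplitz-even c m ⟨
  toeplitz c (m + m)                                 ∎
  where
  open ≡-Reasoning
  eq : ∀ q M m → q * (2 * M) + (m + m) ≡ (q * M + m) + (q * M + m)
  eq = solve-∀
... | inj₂ (m , refl) = begin
  toeplitz c (q * 2 ^ suc e + suc (m + m))           ≡⟨ cong (toeplitz c) (eq q (2 ^ e) m) ⟩
  toeplitz c (suc ((q * 2 ^ e + m) + (q * 2 ^ e + m))) ≡⟨ toeplitz-odd c (q * 2 ^ e + m) ⟩
  toeplitz (c ∘ suc) (q * 2 ^ e + m)                 ≡⟨ toeplitz-periodic e (c ∘ suc) q m m< ⟩
  toeplitz (c ∘ suc) m                               ≡⟨ toeplitz-odd c m ⟨
  toeplitz c (suc (m + m))                           ∎
  where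
  open ≡-Reasoning
  eq : ∀ q M m → q * (2 * M) + suc (m + m) ≡ suc ((q * M + m) + (q * M + m))
  eq = solve-∀
  eq₂ : ∀ m → suc (suc (m + m)) ≡ 2 * suc m
  eq₂ = solve-∀
  m< : suc m < 2 ^ e
  m< = *-cancelˡ-< 2 (suc m) (2 ^ e) (subst (_< 2 ^ suc e) (eq₂ m) i<)

next-multiple : ∀ M → 0 < M → ∀ s → ∃[ q ] ∃[ d ] s + d ≡ q * M × d ≤ M
next-multiple (suc M) _ zero = 0 , 0 , refl , z≤n
next-multiple (suc M) 0<M (suc s) with next-multiple (suc M) 0<M s
... | q , suc d , eq , d≤M = q , d , trans (≡-sym (+-suc s d)) eq , ≤-trans (n≤1+n d) d≤M
... | q , zero  , eq , _   = suc q , M , eq₂ , n≤1+n M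
  where
  eq₂ : suc s + M ≡ suc q * suc M
  eq₂ = cong suc (trans (+-comm s M) (cong (M +_) (trans (≡-sym (+-identityʳ s)) eq)))

k<2^k : ∀ k → k < 2 ^ k
k<2^k zero    = s≤s z≤n
k<2^k (suc k) = ≤-trans (+-mono-≤ (m^n>0 2 k) (k<2^k k)) (+-monoʳ-≤ (2 ^ k) (m≤m+n (2 ^ k) 0))

-- Uniform recurrence stated for prefixes: each window of length `K` contains the prefix of length
-- `k`. Other factors are covered because they lie in prefixes.
Recurrent : (ℕ → Bool) → Set
Recurrent u = ∀ k → ∃[ K ] ∀ s → ∃[ d ] d + k ≤ K × (∀ {i} → i < k → u (s + (d + i)) ≡ u i)

-- The prefix reappears at every multiple of `2 ^ k`, and the next multiple is at most `2 ^ k` away.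
toeplitz-recurrent : ∀ c → Recurrent (toeplitz c)
toeplitz-recurrent c k = 2 ^ k + k , λ s →
  let q , d , s+d≡ , d≤ = next-multiple (2 ^ k) (m^n>0 2 k) s in
  d , +-monoˡ-≤ k d≤ , λ {i} i<k →
    trans (cong (toeplitz c) (trans (≡-sym (+-assoc s d i)) (cong (_+ i) s+d≡)))
          (toeplitz-periodic k c q i (≤-trans (s≤s i<k) (k<2^k k)))

-- Recovering a sequence from a factor of its Toeplitz word

NoTriple : (ℕ → Bool) → Set
NoTriple c = ∀ l → ¬ (c l ≡ c (1 + l) × c (1 + l) ≡ c (2 + l))

-- A prefix length from which `c l` can be read. Eight letters include the positions 1, 3, 7. The
-- extra one in the successor case keeps a halved reflection point at least as large as the smaller
-- window.
window : ℕ → ℕ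
window zero    = 8
window (suc l) = suc (window l + window l)

8≤window : ∀ l → 8 ≤ window l
8≤window zero    = ≤-refl
8≤window (suc l) = ≤-trans (8≤window l) (m≤n⇒m≤1+n (m≤m+n _ _))

double-< : ∀ {i n} → i < n → suc (i + i) < suc (n + n)
double-< i<n = s≤s (+-mono-<-≤ i<n (<⇒≤ i<n))

-- The letters at the positions 1, 3, 7 are c 1, c 2, c 3.
odd-letters-vary : ∀ {c b} → NoTriple c → toeplitz c 1 ≡ b → toeplitz c 3 ≡ b → toeplitz c 7 ≡ b → ⊥
odd-letters-vary nt p q r = nt 1 (trans p (≡-sym q) , trans q (≡-sym r))

-- A shift by an odd amount matches odd positions of the first word with even
-- positions of the second, where the letter is constant.
prefix-factor : ∀ l {c c′} o → NoTriple c →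
  (∀ {i} → i < window l → toeplitz c i ≡ toeplitz c′ (o + i)) → c l ≡ c′ l
prefix-factor l {c} {c′} o nt match with parity o
prefix-factor l {c} {c′} o nt match | inj₂ (p , refl) =
  ⊥-elim (odd-letters-vary {c} nt
    (at 1 (m≤m+n 2 _) (1 + p) (eq₁ p)) (at 3 (m≤m+n 4 _) (2 + p) (eq₃ p)) (at 7 ≤-refl (4 + p) (eq₇ p)))
  where
  at : ∀ i → i < 8 → ∀ m → suc (p + p) + i ≡ m + m → toeplitz c i ≡ c′ 0
  at i i<8 m eq = trans (match (≤-trans i<8 (8≤window l))) (trans (cong (toeplitz c′) eq) (toeplitz-even c′ m))
  eq₁ : ∀ p → suc (p + p) + 1 ≡ (1 + p) + (1 + p)
  eq₁ = solve-∀
  eq₃ : ∀ p → suc (p + p) + 3 ≡ (2 + p) + (2 + p)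
  eq₃ = solve-∀
  eq₇ : ∀ p → suc (p + p) + 7 ≡ (4 + p) + (4 + p)
  eq₇ = solve-∀
prefix-factor zero {c} {c′} o nt match | inj₁ (p , refl) =
  trans (match (s≤s z≤n)) (trans (cong (toeplitz c′) (+-identityʳ (p + p))) (toeplitz-even c′ p))
prefix-factor (suc l) {c} {c′} o nt match | inj₁ (p , refl) =
  -- An even shift matches odd positions with odd positions, that is, the words of the two shifted
  -- sequences with each other.
  prefix-factor l p (nt ∘ suc) λ {i} i< → begin
    toeplitz (c ∘ suc) i                  ≡⟨ toeplitz-odd c i ⟨
    toeplitz c (suc (i + i))              ≡⟨ match (double-< i<) ⟩
    toeplitz c′ (p + p + suc (i + i))     ≡⟨ cong (toeplitz c′) (eq p i) ⟩
    toeplitz c′ (suc ((p + i) + (p + i))) ≡⟨ toeplitz-odd c′ (p + i) ⟩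
    toeplitz (c′ ∘ suc) (p + i)           ∎
  where
  open ≡-Reasoning
  eq : ∀ p i → p + p + suc (i + i) ≡ suc ((p + i) + (p + i))
  eq = solve-∀

-- The reflection sends `i` to `j` with `i + j ≡ o`; `window l ≤ o` provides a partner for each
-- position of the window. An odd `o` exchanges parities, an even one keeps them.
prefix-reversed-factor : ∀ l {c c′} o → NoTriple c → window l ≤ o →
  (∀ {i j} → i < window l → i + j ≡ o → toeplitz c i ≡ toeplitz c′ j) → c l ≡ c′ l
prefix-reversed-factor l {c} {c′} o nt w≤o match with parity o
prefix-reversed-factor l {c} {c′} o nt w≤o match | inj₂ (p , refl) with p | ≤-trans (8≤window l) w≤o
... | 0 | s≤s ()
... | 1 | s≤s (s≤s (s≤s ()))
... | 2 | s≤s (s≤s (s≤s (s≤s (s≤s ()))))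
-- Here `o` is `7 + (p′ + p′)`, so the positions 1, 3, 7 are all reflected to even positions.
... | suc (suc (suc p′)) | _ =
  ⊥-elim (odd-letters-vary {c} nt
    (at 1 (m≤m+n 2 _) (3 + p′) refl) (at 3 (m≤m+n 4 _) (2 + p′) (eq₃ p′)) (at 7 ≤-refl p′ (eq₇ p′)))
  where
  at : ∀ i → i < 8 → ∀ m → i + (m + m) ≡ suc (3 + p′ + (3 + p′)) → toeplitz c i ≡ c′ 0
  at i i<8 m eq = trans (match (≤-trans i<8 (8≤window l)) eq) (toeplitz-even c′ m)
  eq₃ : ∀ p → 3 + ((2 + p) + (2 + p)) ≡ suc (3 + p + (3 + p))
  eq₃ = solve-∀
  eq₇ : ∀ p → 7 + (p + p) ≡ suc (3 + p + (3 + p))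
  eq₇ = solve-∀
prefix-reversed-factor zero {c} {c′} o nt w≤o match | inj₁ (p , refl) =
  trans (match (s≤s z≤n) refl) (toeplitz-even c′ p)
prefix-reversed-factor (suc l) {c} {c′} o nt w≤o match | inj₁ (suc p , refl) =
  prefix-reversed-factor l p (nt ∘ suc)
    (≮⇒≥ λ p<w → <⇒≱ (s≤s (+-mono-≤ p<w p<w)) w≤o) λ {i} {j} i< i+j≡p → begin
    toeplitz (c ∘ suc) i       ≡⟨ toeplitz-odd c i ⟨
    toeplitz c (suc (i + i))   ≡⟨ match (double-< i<) (trans (eq i j) (cong (λ m → suc m + suc m) i+j≡p)) ⟩
    toeplitz c′ (suc (j + j))  ≡⟨ toeplitz-odd c′ j ⟩
    toeplitz (c′ ∘ suc) j      ∎
  where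
  open ≡-Reasoning
  eq : ∀ i j → suc (i + i) + suc (j + j) ≡ suc (i + j) + suc (i + j)
  eq = solve-∀

-- Each bit is followed by its complement, and any three consecutive places contain such a pair.
code : (ℕ → Bool) → ℕ → Bool
code b 0             = b 0
code b 1             = not (b 0)
code b (suc (suc l)) = code (b ∘ suc) l

code-noTriple : ∀ b → NoTriple (code b)
code-noTriple b zero          (p , _) = Bool.not-¬ refl p
code-noTriple b (suc zero)    (_ , q) = Bool.not-¬ refl q
code-noTriple b (suc (suc l)) p       = code-noTriple (b ∘ suc) l p

code-even : ∀ b n → code b (n + n) ≡ b n
code-even b zero    = refl
code-even b (suc n) rewrite +-suc n n = code-even (b ∘ suc) n

-- The graphs and their long induced paths

Consecutive : ℕ → ℕ → Set
Consecutive i j = (suc i ≡ j) ⊎ (suc j ≡ i)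

consecutive-≢ : ∀ {i} → ¬ Consecutive i i
consecutive-≢ (inj₁ p) = 1+n≢n p
consecutive-≢ (inj₂ p) = 1+n≢n p

-- The component numbered `n` is a path with `n` vertices. The bound is irrelevant, so a vertex is
-- determined by its two numbers.
record Vertex : Set where
  constructor vertex
  field
    comp pos  : ℕ
    .pos<comp : pos < comp
open Vertex

vertex-≡ : ∀ {v w} → comp v ≡ comp w → pos v ≡ pos w → v ≡ w
vertex-≡ refl refl = refl

module Adjacency (u : ℕ → Bool) where

  Adj : Vertex → Vertex → Set
  Adj v w = (comp v ≡ comp w × Consecutive (pos v) (pos w)) ⊎
            (comp v ≢ comp w × u (pos v) ≡ true × u (pos w) ≡ true)

  Adj-sym : ∀ {v w} → Adj v w → Adj w v
  Adj-sym (inj₁ (p , c))     = inj₁ (≡-sym p , swap c)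
  Adj-sym (inj₂ (p , l , r)) = inj₂ (p ∘ ≡-sym , r , l)

  graph : Graph
  graph = record
    { V = Vertex ; E = Adj ; sym = λ {v} {w} → Adj-sym {v} {w}
    ; irrefl = λ { (inj₁ (_ , c)) → consecutive-≢ c ; (inj₂ (p , _)) → p refl } }

  -- Adjacency depends only on labels, on equality of components and on consecutiveness inside a
  -- component. Both the minimality embedding and the embedding built from words are checked through
  -- this.
  Adj-transfer : ∀ {v w v′ w′} →
    u (pos v′) ≡ u (pos v) → u (pos w′) ≡ u (pos w) →
    (comp v ≡ comp w → comp v′ ≡ comp w′) →
    (comp v′ ≡ comp w′ → comp v ≡ comp w) →
    (comp v ≡ comp w → Consecutive (pos v) (pos w) → Consecutive (pos v′) (pos w′)) →
    (comp v ≡ comp w → Consecutive (pos v′) (pos w′) → Consecutive (pos v) (pos w)) →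
    (Adj v w → Adj v′ w′) × (Adj v′ w′ → Adj v w)
  Adj-transfer {v} {w} {v′} {w′} lv lw to from next prev = to′ , from′
    where
    to′ : Adj v w → Adj v′ w′
    to′ (inj₁ (p , c))     = inj₁ (to p , next p c)
    to′ (inj₂ (p , l , r)) = inj₂ (p ∘ from , trans lv l , trans lw r)
    from′ : Adj v′ w′ → Adj v w
    from′ (inj₁ (p , c))     = inj₁ (from p , prev (from p) c)
    from′ (inj₂ (p , l , r)) = inj₂ (p ∘ to , trans (≡-sym lv) l , trans (≡-sym lw) r)

Monotone : ℕ → (ℕ → ℕ) → Set
Monotone m ρ = (∀ {i} → i ≤ m → ρ i ≡ ρ 0 + i) ⊎ (∀ {i} → i ≤ m → ρ i + i ≡ ρ 0)

-- A walk with unit steps that changes direction is back after two steps.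
walk-monotone : ∀ m (ρ : ℕ → ℕ) →
  (∀ {i} → i < m → Consecutive (ρ i) (ρ (suc i))) →
  (∀ {i} → suc i < m → ρ i ≢ ρ (suc (suc i))) → Monotone m ρ
walk-monotone zero ρ step nb = inj₁ λ { z≤n → ≡-sym (+-identityʳ (ρ 0)) }
walk-monotone (suc zero) ρ step nb = ⊎-map up down (step (s≤s z≤n))
  where
  up : suc (ρ 0) ≡ ρ 1 → ∀ {i} → i ≤ 1 → ρ i ≡ ρ 0 + i
  up p z≤n       = ≡-sym (+-identityʳ (ρ 0))
  up p (s≤s z≤n) = trans (≡-sym p) (+-comm 1 (ρ 0))
  down : suc (ρ 1) ≡ ρ 0 → ∀ {i} → i ≤ 1 → ρ i + i ≡ ρ 0
  down p z≤n       = +-identityʳ (ρ 0)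
  down p (s≤s z≤n) = trans (+-comm (ρ 1) 1) p
walk-monotone (suc (suc m)) ρ step nb
  with walk-monotone (suc m) ρ (step ∘ m≤n⇒m≤1+n) (nb ∘ m≤n⇒m≤1+n) | step {suc m} ≤-refl
... | inj₁ up | inj₁ p = inj₁ λ i≤ → [ up ∘ s≤s⁻¹ , (λ { refl → up-end }) ]′ (m≤n⇒m<n∨m≡n i≤)
  where
  up-end : ρ (2 + m) ≡ ρ 0 + (2 + m)
  up-end = trans (≡-sym p) (trans (cong suc (up ≤-refl)) (≡-sym (+-suc (ρ 0) (suc m))))
... | inj₁ up | inj₂ p = contradiction (ℕ.suc-injective turn) (nb ≤-refl)
  where
  turn : suc (ρ m) ≡ suc (ρ (2 + m))
  turn = trans (cong suc (up (n≤1+n m))) (trans (≡-sym (+-suc (ρ 0) m)) (≡-sym (trans p (up ≤-refl))))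
... | inj₂ down | inj₂ p = inj₂ λ i≤ → [ down ∘ s≤s⁻¹ , (λ { refl → down-end }) ]′ (m≤n⇒m<n∨m≡n i≤)
  where
  down-end : ρ (2 + m) + (2 + m) ≡ ρ 0
  down-end = trans (+-suc _ (suc m)) (trans (cong (_+ suc m) p) (down ≤-refl))
... | inj₂ down | inj₁ p = contradiction (trans (+-cancelʳ-≡ m _ _ turn) p) (nb ≤-refl)
  where
  turn : ρ m + m ≡ suc (ρ (suc m)) + m
  turn = trans (down (n≤1+n m)) (≡-sym (trans (≡-sym (+-suc (ρ (suc m)) m)) (down ≤-refl)))

-- Indices beyond `m` are sent to `m`, so a path becomes a sequence over ℕ and its indices obey
-- plain arithmetic.
clamp : ∀ m → ℕ → Fin (suc m)
clamp m i = fromℕ< (s≤s (m⊓n≤m m i))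

toℕ-clamp : ∀ {m i} → i ≤ m → toℕ (clamp m i) ≡ i
toℕ-clamp {m} {i} i≤m = trans (toℕ-fromℕ< (s≤s (m⊓n≤m m i))) (m≥n⇒m⊓n≡n i≤m)

module LongPaths (u : ℕ → Bool) (u-even : ∀ m → u (m + m) ≡ true) where
  open Adjacency u

  one-of-two : ∀ {i j} → Consecutive i j → u i ≡ true ⊎ u j ≡ true
  one-of-two {i} c with parity i | c
  ... | inj₁ (m , refl) | _         = inj₁ (u-even m)
  ... | inj₂ (m , refl) | inj₁ refl = inj₂ (trans (cong u (cong suc (≡-sym (+-suc m m)))) (u-even (suc m)))
  ... | inj₂ (m , refl) | inj₂ refl = inj₂ (u-even m)

  edge-label : ∀ {v w} → Adj v w → u (pos v) ≡ true ⊎ u (pos w) ≡ true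
  edge-label (inj₁ (_ , c))     = one-of-two c
  edge-label (inj₂ (_ , l , _)) = inj₁ l

  module _ {m} (6≤m : 6 ≤ m) (f : Fin (suc m) → Vertex)
           (to   : ∀ i j → pathAdj i j → Adj (f i) (f j))
           (from : ∀ i j → Adj (f i) (f j) → pathAdj i j) where

    g : ℕ → Vertex
    g = f ∘ clamp m

    g-to : ∀ {i j} → i ≤ m → j ≤ m → Consecutive i j → Adj (g i) (g j)
    g-to i≤m j≤m = to _ _ ∘ subst₂ Consecutive (≡-sym (toℕ-clamp i≤m)) (≡-sym (toℕ-clamp j≤m))

    g-from : ∀ {i j} → i ≤ m → j ≤ m → Adj (g i) (g j) → Consecutive i j
    g-from i≤m j≤m = subst₂ Consecutive (toℕ-clamp i≤m) (toℕ-clamp j≤m) ∘ from _ _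

    -- If consecutive path vertices lie in different components, both are labelled
    -- true, so every true vertex is adjacent to one of them; but any two
    -- consecutive path vertices include a true one.
    same-comp-step : ∀ {i} → i < m → comp (g i) ≡ comp (g (suc i))
    same-comp-step {i} i<m with comp (g i) ≟ comp (g (suc i))
    ... | yes p = p
    ... | no i≢i+1 = ⊥-elim (distant-edge (3 ≤? i))
      where
      labels : u (pos (g i)) ≡ true × u (pos (g (suc i))) ≡ true
      labels with g-to (<⇒≤ i<m) i<m (inj₁ refl)
      ... | inj₁ (p , _) = contradiction p i≢i+1
      ... | inj₂ (_ , l) = l

      distant : ∀ {t} → t ≤ m → ¬ Consecutive t i → ¬ Consecutive t (suc i) → u (pos (g t)) ≢ true
      distant {t} t≤m ¬i ¬i+1 l with comp (g t) ≟ comp (g i)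
      ... | no  t≢i = ¬i (g-from t≤m (<⇒≤ i<m) (inj₂ (t≢i , l , proj₁ labels)))
      ... | yes t≡i = ¬i+1 (g-from t≤m i<m
        (inj₂ ((λ t≡i+1 → i≢i+1 (trans (≡-sym t≡i) t≡i+1)) , l , proj₂ labels)))

      not-near : ∀ {a b} → suc a < b → ¬ Consecutive a b × ¬ Consecutive b a
      not-near lt = (λ { (inj₁ refl) → <-irrefl refl lt ; (inj₂ refl) → <⇒≱ lt (m≤n⇒m≤1+n (n≤1+n _)) })
                  , (λ { (inj₂ refl) → <-irrefl refl lt ; (inj₁ refl) → <⇒≱ lt (m≤n⇒m≤1+n (n≤1+n _)) })

      -- The edge must keep distance two from `i` and `suc i`. It is `i ∸ 3`, `i ∸ 2` if possible;
      -- otherwise `i ≤ 2`, and `3 + i`, `4 + i` fit because `6 ≤ m`.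
      distant-edge : Dec (3 ≤ i) → ⊥
      distant-edge (yes 3≤i) =
        [ distant t≤m (proj₁ (not-near (<⇒≤ 2+t<i))) (proj₁ (not-near (m≤n⇒m≤1+n (<⇒≤ 2+t<i))))
        , distant t<m (proj₁ (not-near 2+t<i)) (proj₁ (not-near (m≤n⇒m≤1+n 2+t<i)))
        ]′ (edge-label {g t} {g (suc t)} (g-to t≤m t<m (inj₁ refl)))
        where
        t : ℕ
        t = i ∸ 3
        2+t<i : 2 + t < i
        2+t<i = ≤-reflexive (m+[n∸m]≡n 3≤i)
        t<m : t < m
        t<m = ≤-trans (s≤s (m∸n≤m i 3)) i<m
        t≤m : t ≤ m
        t≤m = <⇒≤ t<m
      distant-edge (no 3≰i) =
        [ distant 3+i≤m (proj₂ (not-near (m≤n+m _ 1))) (proj₂ (not-near ≤-refl))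
        , distant 4+i≤m (proj₂ (not-near (m≤n+m _ 2))) (proj₂ (not-near (m≤n+m _ 1)))
        ]′ (edge-label {g (3 + i)} {g (4 + i)} (g-to 3+i≤m 4+i≤m (inj₁ refl)))
        where
        4+i≤m : 4 + i ≤ m
        4+i≤m = ≤-trans (+-monoʳ-≤ 4 (s≤s⁻¹ (≰⇒> 3≰i))) 6≤m
        3+i≤m : 3 + i ≤ m
        3+i≤m = <⇒≤ 4+i≤m

    same-comp : ∀ {i} → i ≤ m → comp (g i) ≡ comp (g 0)
    same-comp {zero}  _   = refl
    same-comp {suc i} i<m = trans (≡-sym (same-comp-step i<m)) (same-comp (<⇒≤ i<m))

    path-step : ∀ {i} → i < m → Consecutive (pos (g i)) (pos (g (suc i)))
    path-step i<m with g-to (<⇒≤ i<m) i<m (inj₁ refl)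
    ... | inj₁ (_ , c) = c
    ... | inj₂ (p , _) = contradiction (same-comp-step i<m) p

    -- Vertices at distance two on a path with at least four vertices are not twins.
    no-backtrack : ∀ {i} → suc i < m → pos (g i) ≢ pos (g (suc (suc i)))
    no-backtrack {i} i+1<m eq = twins i i+1<m (vertex-≡ (trans (same-comp-step i<m) (same-comp-step i+1<m)) eq)
      where
      i<m : i < m
      i<m = <⇒≤ i+1<m
      twins : ∀ i → suc i < m → g i ≢ g (suc (suc i))
      -- The vertex telling the twins apart is 3 at the start of the path, and the preceding path
      -- vertex elsewhere.
      twins zero 1<m eq with g-from 3≤m z≤n (subst (Adj (g 3)) (≡-sym eq) (g-to 3≤m 1<m (inj₂ refl)))
        where
        3≤m : 3 ≤ m
        3≤m = ≤-trans (m≤m+n 3 3) 6≤m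
      ... | inj₁ ()
      ... | inj₂ ()
      twins (suc i) i+2<m eq with g-from i≤m i+2<m (subst (Adj (g i)) eq (g-to i≤m i+1≤m (inj₁ refl)))
        where
        i≤m : i ≤ m
        i≤m = m+n≤o⇒n≤o 3 i+2<m
        i+1≤m : suc i ≤ m
        i+1≤m = m+n≤o⇒n≤o 2 i+2<m
      ... | inj₁ p = m≢1+m+n i {1} (trans (ℕ.suc-injective p) (cong suc (+-comm 1 i)))
      ... | inj₂ p = m≢1+m+n i {3} (trans (≡-sym p) (cong suc (+-comm 3 i)))

    path-monotone : Monotone m (pos ∘ g)
    path-monotone = walk-monotone m (pos ∘ g) path-step no-backtrack

-- Minimality and incomparability

module Minimality (u : ℕ → Bool) (u-even : ∀ m → u (m + m) ≡ true) (u-recurrent : Recurrent u) where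
  open Adjacency u
  open LongPaths u u-even

  unboundedPaths : UnboundedPaths graph
  unboundedPaths n = n , ≤-refl , (λ i → vertex (suc n) (toℕ i) (toℕ<n i)) ,
    (λ i j p → toℕ-injective (cong pos p)) ,
    λ i j → (λ c → inj₁ (refl , c)) , λ { (inj₁ (_ , c)) → c ; (inj₂ (p , _)) → contradiction refl p }

  module _ (P : Vertex → Set) (unbounded : UnboundedPaths (Induced graph P)) where

    Member : ℕ → ℕ → Set
    Member c p = Σ[ lt ∈ p < c ] P (vertex c p lt)

    member : ∀ {c p v} → comp v ≡ c → pos v ≡ p → P v → Member c p
    member {v = vertex c p p<c} refl refl Pv = recompute (p <? c) p<c , Pv

    interval : ∀ n → ∃[ c ] ∃[ s ] (∀ {j} → j ≤ n → Member c (s + j))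
    interval n with unbounded (n ⊔ 6)
    ... | m , n⊔6≤m , f , _ , f-edge = result (path-monotone 6≤m h to from)
      where
      6≤m : 6 ≤ m
      6≤m = m⊔n≤o⇒n≤o n 6 n⊔6≤m
      n≤m : n ≤ m
      n≤m = m⊔n≤o⇒m≤o n 6 n⊔6≤m
      h : Fin (suc m) → Vertex
      h = proj₁ ∘ f
      to : ∀ i j → pathAdj i j → Adj (h i) (h j)
      to i j = proj₁ (f-edge i j)
      from : ∀ i j → Adj (h i) (h j) → pathAdj i j
      from i j = proj₂ (f-edge i j)
      c : ℕ
      c = comp (h (clamp m 0))
      ρ : ℕ → ℕ
      ρ = pos ∘ h ∘ clamp m
      at : ∀ {i p} → i ≤ m → ρ i ≡ p → Member c p
      at {i} i≤m eq = member {v = h (clamp m i)} (same-comp 6≤m h to from i≤m) eq (proj₂ (f (clamp m i)))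
      result : Monotone m ρ → ∃[ c ] ∃[ s ] (∀ {j} → j ≤ n → Member c (s + j))
      result (inj₁ up) = c , ρ 0 , λ j≤n → at (≤-trans j≤n n≤m) (up (≤-trans j≤n n≤m))
      -- A descending path is read from its last vertex: position `ρ m + j` is taken at index
      -- `m ∸ j`.
      result (inj₂ down) = c , ρ m , λ {j} j≤n →
        let j≤m = ≤-trans j≤n n≤m in
        at (m∸n≤m m j) (+-cancelʳ-≡ (m ∸ j) _ _ (begin
          ρ (m ∸ j) + (m ∸ j)    ≡⟨ down (m∸n≤m m j) ⟩
          ρ 0                    ≡⟨ down ≤-refl ⟨
          ρ m + m                ≡⟨ cong (ρ m +_) (m+[n∸m]≡n j≤m) ⟨
          ρ m + (j + (m ∸ j))    ≡⟨ +-assoc (ρ m) j (m ∸ j) ⟨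
          ρ m + j + (m ∸ j)      ∎))
        where open ≡-Reasoning

    -- A place for the component `k` inside `P`: an interval labelled by the prefix of length `k`,
    -- in a component numbered above `l`.
    record Host (k l : ℕ) : Set where
      field
        index start : ℕ
        l<index     : l < index
        label       : ∀ {i} → i < k → u (start + i) ≡ u i
        present     : ∀ {i} → i < k → Member index (start + i)
    open Host

    host : ∀ k l → Host k l
    host k l with u-recurrent k
    -- The length `K` leaves room for the prefix, and `l` pushes the component number past `l`,
    -- since position `s + (K ⊔ l)` lies in that component.
    ... | K , rec with interval (K ⊔ l)
    ...   | c , s , mem with rec s
    ...     | d , d+k≤K , lab = record
      { index   = c
      ; start   = s + d
      ; l<index = ≤-trans (s≤s (≤-trans (m≤n⊔m K l) (m≤n+m (K ⊔ l) s))) (proj₁ (mem ≤-refl))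
      ; label   = λ {i} i<k → trans (cong u (+-assoc s d i)) (lab i<k)
      ; present = λ {i} i<k → subst (Member c) (≡-sym (+-assoc s d i))
          (mem (≤-trans (≤-trans (+-monoʳ-≤ d (<⇒≤ i<k)) d+k≤K) (m≤m⊔n K l)))
      }

    -- The bound of each host is the index of the preceding one, so the chosen components are
    -- strictly increasing and hence distinct.
    hosts : ∀ k → ∃ (Host k)
    hosts zero    = 0 , host 0 0
    hosts (suc k) = index (proj₂ (hosts k)) , host (suc k) _

    C S : ℕ → ℕ
    C k = index (proj₂ (hosts k))
    S k = start (proj₂ (hosts k))

    C-mono : ∀ {j k} → j < k → C j < C k
    C-mono {j} {suc k} j<k =
      [ (λ j<k′ → <-trans (C-mono j<k′) step) , (λ { refl → step }) ]′ (m≤n⇒m<n∨m≡n (s≤s⁻¹ j<k))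
      where
      step : C k < C (suc k)
      step = l<index (proj₂ (hosts (suc k)))

    C-injective : ∀ {j k} → C j ≡ C k → j ≡ k
    C-injective {j} {k} eq with <-cmp j k
    ... | tri< j<k _ _ = contradiction eq (<⇒≢ (C-mono j<k))
    ... | tri≈ _ j≡k _ = j≡k
    ... | tri> _ _ k<j = contradiction (≡-sym eq) (<⇒≢ (C-mono k<j))

    φ : Vertex → Σ Vertex P
    φ (vertex k i i<k) = let lt , p = present (proj₂ (hosts k)) (recompute (i <? k) i<k) in
      vertex (C k) (S k + i) lt , p

    embeds : graph ↪ Induced graph P
    embeds = φ , injective , edges
      where
      injective : ∀ v w → φ v ≡ φ w → v ≡ w
      injective (vertex k i i<k) (vertex k′ i′ _) eq with C-injective {k} {k′} (cong (comp ∘ proj₁) eq)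
      ... | refl = vertex-≡ refl (+-cancelˡ-≡ (S k) i i′ (cong (pos ∘ proj₁) eq))

      label-φ : ∀ v → u (pos (proj₁ (φ v))) ≡ u (pos v)
      label-φ (vertex k i i<k) = label (proj₂ (hosts k)) (recompute (i <? k) i<k)

      edges : ∀ v w → (Adj v w → Adj (proj₁ (φ v)) (proj₁ (φ w))) ×
                      (Adj (proj₁ (φ v)) (proj₁ (φ w)) → Adj v w)
      edges v w = Adj-transfer {v} {w} {proj₁ (φ v)} {proj₁ (φ w)} (label-φ v) (label-φ w)
        (cong C) (C-injective {comp v} {comp w})
        (λ { refl → ⊎-map shift shift }) (λ { refl → ⊎-map unshift unshift })
        where
        s : ℕ
        s = S (comp v)
        shift : ∀ {i j} → suc i ≡ j → suc (s + i) ≡ s + j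
        shift {i} p = trans (≡-sym (+-suc s i)) (cong (s +_) p)
        unshift : ∀ {i j} → suc (s + i) ≡ s + j → suc i ≡ j
        unshift {i} p = +-cancelˡ-≡ s _ _ (trans (+-suc s i) p)

  pathMinimal : PathMinimal graph
  pathMinimal = unboundedPaths , embeds

-- Keeps the outer probe vertex out of the component of the path: it sees the path vertices 0 and 4,
-- whose positions differ by four. Positions differing by two could share a neighbour.
far-apart : ∀ {a b} → Consecutive a (4 + b) → ¬ Consecutive a b
far-apart (inj₁ refl) (inj₁ eq) = <⇒≢ (m≤n+m _ 3) (≡-sym eq)
far-apart (inj₁ refl) (inj₂ eq) = <⇒≢ (s≤s (m≤n+m _ 1)) eq
far-apart (inj₂ refl) (inj₁ eq) = <⇒≢ (m≤n+m _ 5) (≡-sym eq)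
far-apart (inj₂ refl) (inj₂ eq) = <⇒≢ (s≤s (m≤n+m _ 3)) eq

module Incomparability {c c′ : ℕ → Bool} (c-noTriple : NoTriple c)
                       (c-true : c 0 ≡ true) (c′-true : c′ 0 ≡ true) where

  u u′ : ℕ → Bool
  u  = toeplitz c
  u′ = toeplitz c′

  u-even : ∀ m → u (m + m) ≡ true
  u-even m = trans (toeplitz-even c m) c-true

  u′-even : ∀ m → u′ (m + m) ≡ true
  u′-even m = trans (toeplitz-even c′ m) c′-true

  module X = Adjacency u
  module Y = Adjacency u′
  open LongPaths u′ u′-even

  -- A long component together with a true vertex outside of it, from which the
  -- labels of the component can be read off.
  probe : ∀ m → Fin (2 + m) → Vertex
  probe m zero    = vertex 1 0 (s≤s z≤n)
  probe m (suc i) = vertex (suc m) (toℕ i) (toℕ<n i)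

  probeGraph : ℕ → Graph
  probeGraph m = record
    { V = Fin (2 + m) ; E = λ i j → X.Adj (probe m i) (probe m j)
    ; sym = λ {i} {j} → sym X.graph {probe m i} {probe m j}
    ; irrefl = λ {i} → irrefl X.graph {probe m i} }

  -- `0 < m` separates the long component `suc m` from component 1, which holds the outer vertex.
  probe-inAge : ∀ {m} → 0 < m → InAge X.graph (probeGraph m)
  probe-inAge {m} 0<m = (2 + m , ↔-id _) , probe m , injective , λ _ _ → id , id
    where
    injective : ∀ i j → probe m i ≡ probe m j → i ≡ j
    injective zero    zero    _  = refl
    injective zero    (suc j) eq = contradiction (ℕ.suc-injective (cong comp eq)) (<⇒≢ 0<m)
    injective (suc i) zero    eq = contradiction (ℕ.suc-injective (≡-sym (cong comp eq))) (<⇒≢ 0<m)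
    injective (suc i) (suc j) eq = cong suc (toℕ-injective (cong pos eq))

  module _ {l} (e : probeGraph (window l) ↪ Y.graph) where

    m : ℕ
    m = window l

    0<m : 0 < m
    0<m = ≤-trans (s≤s z≤n) (8≤window l)

    edge-to : ∀ i j → X.Adj (probe m i) (probe m j) → Y.Adj (proj₁ e i) (proj₁ e j)
    edge-to i j = proj₁ (proj₂ (proj₂ e) i j)

    edge-from : ∀ i j → Y.Adj (proj₁ e i) (proj₁ e j) → X.Adj (probe m i) (probe m j)
    edge-from i j = proj₂ (proj₂ (proj₂ e) i j)

    6≤m : 6 ≤ m
    6≤m = ≤-trans (m≤n+m 6 2) (8≤window l)

    f : Fin (suc m) → Vertex
    f i = proj₁ e (suc i)

    to : ∀ i j → pathAdj i j → Y.Adj (f i) (f j)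
    to i j p = edge-to (suc i) (suc j) (inj₁ (refl , p))

    from : ∀ i j → Y.Adj (f i) (f j) → pathAdj i j
    from i j a with edge-from (suc i) (suc j) a
    ... | inj₁ (_ , p) = p
    ... | inj₂ (p , _) = contradiction refl p

    path : ℕ → Vertex
    path = f ∘ clamp m

    w : Vertex
    w = proj₁ e zero

    see : ∀ {i} → i ≤ m → u i ≡ true → Y.Adj w (path i)
    see i≤m p = edge-to zero (suc (clamp m _))
      (inj₂ (<⇒≢ 0<m ∘ ℕ.suc-injective , u-even 0 , trans (cong u (toℕ-clamp i≤m)) p))

    seen : ∀ {i} → i ≤ m → Y.Adj w (path i) → u i ≡ true
    seen i≤m a with edge-from zero (suc (clamp m _)) a
    ... | inj₁ (p , _)     = contradiction (ℕ.suc-injective p) (<⇒≢ 0<m)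
    ... | inj₂ (_ , _ , p) = trans (cong u (≡-sym (toℕ-clamp i≤m))) p

    monotone : Monotone m (pos ∘ path)
    monotone = path-monotone 6≤m f to from

    one-comp : ∀ {i} → i ≤ m → comp (path i) ≡ comp (path 0)
    one-comp = same-comp 6≤m f to from

    4≤m : 4 ≤ m
    4≤m = ≤-trans (m≤n+m 4 2) 6≤m

    outside : comp w ≢ comp (path 0)
    outside p =
      [ (λ up → far-apart (subst (Consecutive (pos w)) (trans (up 4≤m) (+-comm _ 4)) near₄) near₀)
      , (λ down → far-apart (subst (Consecutive (pos w)) (trans (≡-sym (down 4≤m)) (+-comm _ 4)) near₀) near₄)
      ]′ monotone
      where
      near : ∀ {i} → i ≤ m → u i ≡ true → Consecutive (pos w) (pos (path i))
      near i≤m q with see i≤m q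
      ... | inj₁ (_ , c) = c
      ... | inj₂ (r , _) = contradiction (trans p (≡-sym (one-comp i≤m))) r
      near₀ : Consecutive (pos w) (pos (path 0))
      near₀ = near z≤n (u-even 0)
      near₄ : Consecutive (pos w) (pos (path 4))
      near₄ = near 4≤m (u-even 2)

    cross : ∀ {i} → i ≤ m → Y.Adj w (path i) → u′ (pos w) ≡ true × u′ (pos (path i)) ≡ true
    cross i≤m (inj₁ (p , _)) = contradiction (trans p (one-comp i≤m)) outside
    cross i≤m (inj₂ (_ , q)) = q

    -- On both sides the label is true exactly when the outer vertex is adjacent to the path vertex;
    -- the image of the outer vertex is itself labelled true because it sees path vertex 0.
    same-label : ∀ {i} → i ≤ m → u i ≡ u′ (pos (path i))
    same-label {i} i≤m with u i in ui | u′ (pos (path i)) in u′i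
    ... | true  | true  = refl
    ... | false | false = refl
    ... | true  | false = trans (≡-sym (proj₂ (cross i≤m (see i≤m ui)))) u′i
    ... | false | true  = trans (≡-sym ui) (seen i≤m (inj₂
      ((λ p → outside (trans p (one-comp i≤m))) , proj₁ (cross z≤n (see z≤n (u-even 0))) , u′i)))

    same-letter : c l ≡ c′ l
    same-letter with monotone
    ... | inj₁ up = prefix-factor l {c} {c′} (pos (path 0)) c-noTriple
      λ i< → trans (same-label (<⇒≤ i<)) (cong u′ (up (<⇒≤ i<)))
    ... | inj₂ dn = prefix-reversed-factor l {c} {c′} (pos (path 0)) c-noTriple
      (≤-trans (m≤n+m m _) (≤-reflexive (dn ≤-refl)))
      λ {i} i< i+j≡ → trans (same-label (<⇒≤ i<))
        (cong u′ (+-cancelʳ-≡ i _ _ (trans (dn (<⇒≤ i<)) (trans (≡-sym i+j≡) (+-comm i _)))))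

  ageSub⇒≡ : AgeSub X.graph Y.graph → ∀ l → c l ≡ c′ l
  ageSub⇒≡ sub l = same-letter {l}
    (proj₂ (sub (probeGraph (window l)) (probe-inAge (≤-trans (s≤s z≤n) (8≤window l)))))

-- Well-quasi-order

greatest : {P : ℕ → Set} → (∀ n → Dec (P n)) → P 0 → ∀ n →
           ∃[ m ] P m × (∀ {k} → k ≤ n → P k → k ≤ m)
greatest P? P0 zero = 0 , P0 , λ k≤0 _ → k≤0
greatest P? P0 (suc n) with P? (suc n) | greatest P? P0 n
... | yes Pn | _ = suc n , Pn , λ k≤n _ → k≤n
... | no ¬Pn | m , Pm , max = m , Pm , λ k≤1+n Pk →
  [ (λ k<1+n → max (s≤s⁻¹ k<1+n) Pk) , (λ { refl → contradiction Pk ¬Pn }) ]′ (m≤n⇒m<n∨m≡n k≤1+n)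

upper-bound : ∀ {n} (f : Fin n → ℕ) → ∃[ N ] (∀ k → f k < N)
upper-bound {zero}  f = 0 , λ ()
upper-bound {suc n} f with upper-bound (f ∘ suc)
... | N , f<N = suc (f zero) ⊔ N , λ
  { zero → m≤m⊔n (suc (f zero)) N ; (suc k) → ≤-trans (f<N k) (m≤n⊔m (suc (f zero)) N) }

-- A finite set T of positions is encoded by the list of the pairs (p , l), p < N,
-- where l is the length of the maximal interval of T starting at p, or 0 if none does.
module Runs {T : ℕ → Set} (T? : ∀ p → Dec (T p)) where

  next : ∀ {i} → Dec (T i) → ℕ → ℕ
  next     (yes _) s = s
  next {i} (no _)  _ = suc i

  -- The least `s` such that all positions from `s` up to but excluding `i` lie in `T`; for `i` in
  -- `T`, the first position of its run.
  start : ℕ → ℕ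
  start zero    = zero
  start (suc i) = next (T? i) (start i)

  start-suc : ∀ {i} → T i → start (suc i) ≡ start i
  start-suc {i} t with T? i
  ... | yes _ = refl
  ... | no ¬t = contradiction t ¬t

  start-≤ : ∀ i → start i ≤ i
  start-≤ zero = z≤n
  start-≤ (suc i) with T? i
  ... | yes _ = m≤n⇒m≤1+n (start-≤ i)
  ... | no _  = ≤-refl

  start-run : ∀ i {p} → start i ≤ p → p ≤ i → start p ≡ start i × (p < i → T p)
  start-run zero z≤n z≤n = refl , λ ()
  start-run (suc i) {p} s≤p p≤1+i with m≤n⇒m<n∨m≡n p≤1+i
  ... | inj₂ refl  = refl , λ lt → contradiction refl (<⇒≢ lt)
  ... | inj₁ p<1+i with T? i
  ...   | no _  = contradiction s≤p (<⇒≱ p<1+i)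
  ...   | yes t with start-run i s≤p (s≤s⁻¹ p<1+i)
  ...     | eq , Tp = eq , λ _ → [ Tp , (λ { refl → t }) ]′ (m≤n⇒m<n∨m≡n (s≤s⁻¹ p<1+i))

  -- The condition on `start` forces `l` to be 0 unless `p` begins a run, so no run is recorded
  -- twice.
  Run : ℕ → ℕ → Set
  Run p l = ∀ {j} → j < l → T (p + j) × start (p + j) ≡ p

  longest : ∀ N p → ∃[ l ] Run p l × (∀ {k} → k ≤ N → Run p k → k ≤ l)
  longest N p = greatest (allUpTo? (λ j → T? (p + j) ×-dec start (p + j) ≟ p)) (λ ()) N

  len : ℕ → ℕ → ℕ
  len N p = proj₁ (longest N p)

  len-run : ∀ N p → Run p (len N p)
  len-run N p = proj₁ (proj₂ (longest N p))

  offset-< : ∀ {N i} → i < N → T i → i ∸ start i < len N (start i)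
  offset-< {N} {i} i<N t =
    proj₂ (proj₂ (longest N (start i))) (≤-trans (s≤s (m∸n≤m i (start i))) i<N) run
    where
    run : Run (start i) (suc (i ∸ start i))
    run {j} j≤ = [ T< , (λ e → subst T (≡-sym e) t) ]′ (m≤n⇒m<n∨m≡n s+j≤i) , eq
      where
      s+j≤i : start i + j ≤ i
      s+j≤i = ≤-trans (+-monoʳ-≤ (start i) (s≤s⁻¹ j≤)) (≤-reflexive (m+[n∸m]≡n (start-≤ i)))
      eq : start (start i + j) ≡ start i
      eq = proj₁ (start-run i (m≤m+n (start i) j) s+j≤i)
      T< : start i + j < i → T (start i + j)
      T< = proj₂ (start-run i (m≤m+n (start i) j) s+j≤i)

  row : ℕ → List (ℕ × ℕ)
  row N = tabulate {n = N} λ p → toℕ p , len N (toℕ p)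

-- Both equations amount to `δ + k ≡ l`. The value 0 of `δ` serves for injectivity, the value 1 for
-- adjacency.
offset-⇒ : ∀ δ a b {k l} → δ + (a + k) ≡ a + l → δ + (b + k) ≡ b + l
offset-⇒ δ a b {k} {l} eq =
  trans (comm δ b k) (cong (b +_) (+-cancelˡ-≡ a _ _ (trans (≡-sym (comm δ a k)) eq)))
  where
  comm : ∀ δ a k → δ + (a + k) ≡ a + (δ + k)
  comm = solve-∀

-- The order on factors and on the words coding finite induced subgraphs

module Quasiorder (u : ℕ → Bool) (u-recurrent : Recurrent u) where
  open Adjacency u

  -- (s , l) stands for the word of length l at position s of u.
  _⊑_ : ℕ × ℕ → ℕ × ℕ → Set
  (s , l) ⊑ (s′ , l′) =
    ∃[ d ] d < suc l′ × (d + l ≤ l′ × (∀ {i} → i < l → u (s′ + (d + i)) ≡ u (s + i)))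

  _⊑?_ : ∀ x y → Dec (x ⊑ y)
  (s , l) ⊑? (s′ , l′) = anyUpTo?
    (λ d → (d + l ≤? l′) ×-dec allUpTo? (λ i → u (s′ + (d + i)) Bool.≟ u (s + i)) l) (suc l′)

  -- A conjunction of `K` comparisons of single letters, each almost full by the pigeonhole
  -- principle.
  AF-prefix : ∀ K → AF (λ s s′ → ∀ {i} → i < K → u (s′ + i) ≡ u (s + i))
  AF-prefix zero    = now λ _ _ ()
  AF-prefix (suc K) = AF-mono extend (AF-∩ (AF-prefix K) (AF-on (λ s → u (s + K)) AF-≡ᴮ))
    where
    extend : ∀ {s s′} → (∀ {i} → i < K → u (s′ + i) ≡ u (s + i)) × u (s + K) ≡ u (s′ + K) →
             ∀ {i} → i < suc K → u (s′ + i) ≡ u (s + i)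
    extend (eqs , eq) i<1+K with m≤n⇒m<n∨m≡n i<1+K
    ... | inj₁ lt   = eqs (s≤s⁻¹ lt)
    ... | inj₂ refl = ≡-sym eq

  -- The factor played first lies in the prefix of length `s + l`, hence in every factor of length
  -- at least `K`. Shorter factors are compared by their length and their first `K` letters.
  AF-⊑ : AF _⊑_
  AF-⊑ = later λ (s , l) → after s l (u-recurrent (s + l))
    where
    after : ∀ s l →
            ∃[ K ] (∀ s′ → ∃[ d ] d + (s + l) ≤ K × (∀ {i} → i < s + l → u (s′ + (d + i)) ≡ u i)) →
            AF (λ y z → y ⊑ z ⊎ (s , l) ⊑ y)
    after s l (K , rec) = AF-mono (λ {y} {z} → step y z)
      (AF-∩ (AF-on proj₂ AF-≤) (AF-on proj₁ (AF-prefix K)))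
      where
      step : ∀ y z → proj₂ y ≤ proj₂ z × (∀ {i} → i < K → u (proj₁ z + i) ≡ u (proj₁ y + i)) →
             y ⊑ z ⊎ (s , l) ⊑ y
      step (s₁ , l₁) (s₂ , l₂) (l₁≤l₂ , eqs) with K ≤? l₁
      ... | no K≰l₁ = inj₁ (0 , s≤s z≤n , l₁≤l₂ , λ i<l₁ → eqs (<-trans i<l₁ (≰⇒> K≰l₁)))
      ... | yes K≤l₁ with rec s₁
      ...   | d , fits , eq = inj₂ (d + s , s≤s (m+n≤o⇒m≤o (d + s) fits′) , fits′ , λ {i} i<l →
              trans (cong (λ x → u (s₁ + x)) (+-assoc d s i)) (eq (+-monoʳ-< s i<l)))
        where
        fits′ : d + s + l ≤ l₁
        fits′ = ≤-trans (≤-reflexive (+-assoc d s l)) (≤-trans fits K≤l₁)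

  -- Each run is moved as a block: `τ` selects the target run, and the factor embedding gives the
  -- shift inside it.
  module RowEmbedding {T T′ : ℕ → Set} (T? : ∀ p → Dec (T p)) (T′? : ∀ p → Dec (T′ p)) {N N′}
                      (emb : Sublist _⊑_ (Runs.row T? N) (Runs.row T′? N′)) where
    open Runs T?
    module R′ = Runs T′?

    τ : Fin N → Fin N′
    τ = proj₁ (tabulate-embedding _ _ emb)

    τ-injective : ∀ {i j} → τ i ≡ τ j → i ≡ j
    τ-injective = proj₁ (proj₂ (tabulate-embedding _ _ emb))

    τ-⊑ : ∀ p → (toℕ p , len N (toℕ p)) ⊑ (toℕ (τ p) , R′.len N′ (toℕ (τ p)))
    τ-⊑ = proj₂ (proj₂ (tabulate-embedding _ _ emb))

    start<N : (i : Fin N) → start (toℕ i) < N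
    start<N i = ≤-<-trans (start-≤ (toℕ i)) (toℕ<n i)

    startᶠ : Fin N → Fin N
    startᶠ i = fromℕ< (start<N i)

    toℕ-startᶠ : ∀ i → toℕ (startᶠ i) ≡ start (toℕ i)
    toℕ-startᶠ i = toℕ-fromℕ< (start<N i)

    offset : Fin N → ℕ
    offset i = toℕ i ∸ start (toℕ i)

    startᶠ+offset : ∀ i → toℕ (startᶠ i) + offset i ≡ toℕ i
    startᶠ+offset i = trans (cong (_+ offset i) (toℕ-startᶠ i)) (m+[n∸m]≡n (start-≤ (toℕ i)))

    ψ : Fin N → ℕ → ℕ
    ψ p k = toℕ (τ p) + (proj₁ (τ-⊑ p) + k)

    φ : Fin N → ℕ
    φ i = ψ (startᶠ i) (offset i)

    module _ {i : Fin N} (t : T (toℕ i)) where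

      offset<len : offset i < len N (toℕ (startᶠ i))
      offset<len = subst (λ p → offset i < len N p) (≡-sym (toℕ-startᶠ i)) (offset-< (toℕ<n i) t)

      -- The second component recovers the source run from an image position, as `τ` is injective;
      -- so images of distinct runs are neither equal nor consecutive.
      φ-run : T′ (φ i) × R′.start (φ i) ≡ toℕ (τ (startᶠ i))
      φ-run with τ-⊑ (startᶠ i)
      ... | d , _ , fits , _ = R′.len-run N′ _ (<-≤-trans (+-monoʳ-< d offset<len) fits)

      φ-label : u (φ i) ≡ u (toℕ i)
      φ-label with τ-⊑ (startᶠ i)
      ... | d , _ , _ , eq = trans (eq offset<len) (cong u (startᶠ+offset i))

    module _ {i j : Fin N} (tᵢ : T (toℕ i)) (tⱼ : T (toℕ j)) where

      module _ (δ : ℕ) (startᶠ≡ : startᶠ i ≡ startᶠ j) where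

        shift-to : δ + toℕ i ≡ toℕ j → δ + φ i ≡ φ j
        shift-to eq = subst (λ p → δ + φ i ≡ ψ p (offset j)) startᶠ≡
          (subst₂ (λ x y → δ + x ≡ y) (+-assoc a d (offset i)) (+-assoc a d (offset j))
            (offset-⇒ δ (toℕ p) (a + d) (subst₂ (λ x y → δ + x ≡ y) (≡-sym (startᶠ+offset i))
              (≡-sym (trans (cong (λ q → toℕ q + offset j) startᶠ≡) (startᶠ+offset j))) eq)))
          where
          p = startᶠ i
          a = toℕ (τ p)
          d = proj₁ (τ-⊑ p)

        shift-from : δ + φ i ≡ φ j → δ + toℕ i ≡ toℕ j
        shift-from eq = subst₂ (λ x y → δ + x ≡ y) (startᶠ+offset i)
          (trans (cong (λ q → toℕ q + offset j) startᶠ≡) (startᶠ+offset j))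
          (offset-⇒ δ (a + d) (toℕ p)
            (subst₂ (λ x y → δ + x ≡ y) (≡-sym (+-assoc a d (offset i))) (≡-sym (+-assoc a d (offset j)))
            (subst (λ p → δ + φ i ≡ ψ p (offset j)) (≡-sym startᶠ≡) eq)))
          where
          p = startᶠ i
          a = toℕ (τ p)
          d = proj₁ (τ-⊑ p)

      startᶠ-≡ : start (toℕ i) ≡ start (toℕ j) → startᶠ i ≡ startᶠ j
      startᶠ-≡ eq = toℕ-injective (trans (toℕ-startᶠ i) (trans eq (≡-sym (toℕ-startᶠ j))))

      startᶠ-≡′ : R′.start (φ i) ≡ R′.start (φ j) → startᶠ i ≡ startᶠ j
      startᶠ-≡′ eq = τ-injective (toℕ-injective
        (trans (≡-sym (proj₂ (φ-run {i} tᵢ))) (trans eq (proj₂ (φ-run {j} tⱼ)))))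

      φ-injective : φ i ≡ φ j → toℕ i ≡ toℕ j
      φ-injective eq = shift-from 0 (startᶠ-≡′ (cong R′.start eq)) eq

      φ-suc : suc (toℕ i) ≡ toℕ j → suc (φ i) ≡ φ j
      φ-suc eq = shift-to 1 (startᶠ-≡ (trans (≡-sym (start-suc tᵢ)) (cong start eq))) eq

      φ-suc⁻¹ : suc (φ i) ≡ φ j → suc (toℕ i) ≡ toℕ j
      φ-suc⁻¹ eq = shift-from 1
        (startᶠ-≡′ (trans (≡-sym (R′.start-suc (proj₁ (φ-run {i} tᵢ)))) (cong R′.start eq))) eq

  module Word {H : Graph} (inAge : InAge graph H) where
    open Inverse (proj₂ (proj₁ inAge)) using (to; from; strictlyInverseʳ) public

    e : V H → Vertex
    e = proj₁ (proj₂ inAge)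

    -- The quantifier ranges over `Fin` rather than `V H`, which makes the predicate decidable by
    -- search.
    Occupied : ℕ → ℕ → Set
    Occupied c p = ∃[ k ] comp (e (from k)) ≡ c × pos (e (from k)) ≡ p

    occupied? : ∀ c p → Dec (Occupied c p)
    occupied? c p = any? λ k → (comp (e (from k)) ≟ c) ×-dec (pos (e (from k)) ≟ p)

    -- A bound on the component numbers bounds the positions as well, since `pos` is below `comp`.
    N : ℕ
    N = proj₁ (upper-bound (comp ∘ e ∘ from))

    comp<N : ∀ v → comp (e v) < N
    comp<N v = subst (λ v → comp (e v) < N) (strictlyInverseʳ v)
      (proj₂ (upper-bound (comp ∘ e ∘ from)) (to v))

    pos<N : ∀ v → pos (e v) < N
    pos<N v = <-trans (below (e v)) (comp<N v)
      where
      below : ∀ w → pos w < comp w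
      below (vertex c p p<c) = recompute (p <? c) p<c

    compᶠ posᶠ : V H → Fin N
    compᶠ v = fromℕ< (comp<N v)
    posᶠ  v = fromℕ< (pos<N v)

    toℕ-compᶠ : ∀ v → toℕ (compᶠ v) ≡ comp (e v)
    toℕ-compᶠ v = toℕ-fromℕ< (comp<N v)

    toℕ-posᶠ : ∀ v → toℕ (posᶠ v) ≡ pos (e v)
    toℕ-posᶠ v = toℕ-fromℕ< (pos<N v)

    occupied : ∀ v → Occupied (toℕ (compᶠ v)) (toℕ (posᶠ v))
    occupied v = to v , trans (cong (comp ∘ e) (strictlyInverseʳ v)) (≡-sym (toℕ-compᶠ v))
                      , trans (cong (pos ∘ e) (strictlyInverseʳ v)) (≡-sym (toℕ-posᶠ v))

    word : List (List (ℕ × ℕ))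
    word = tabulate {n = N} λ c → Runs.row (occupied? (toℕ c)) N

  -- `σ` moves components injectively and `Row.φ` moves the positions inside each; labels survive
  -- because `_⊑_` compares letters of `u`.
  word-embedding : ∀ {H H′} (h : InAge graph H) (h′ : InAge graph H′) →
    Sublist (Sublist _⊑_) (Word.word {H} h) (Word.word {H′} h′) → H ↪ H′
  word-embedding {H} {H′} h h′ emb = image , injective , edges
    where
    module W  = Word {H} h
    module W′ = Word {H′} h′

    σ : Fin W.N → Fin W′.N
    σ = proj₁ (tabulate-embedding _ _ emb)

    σ-injective : ∀ {i j} → σ i ≡ σ j → i ≡ j
    σ-injective = proj₁ (proj₂ (tabulate-embedding _ _ emb))

    module Row (c : Fin W.N) = RowEmbedding (W.occupied? (toℕ c)) (W′.occupied? (toℕ (σ c)))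
      (proj₂ (proj₂ (tabulate-embedding _ _ emb)) c)

    φ : V H → ℕ
    φ v = Row.φ (W.compᶠ v) (W.posᶠ v)

    found : ∀ v → W′.Occupied (toℕ (σ (W.compᶠ v))) (φ v)
    found v = proj₁ (Row.φ-run (W.compᶠ v) {W.posᶠ v} (W.occupied v))

    image : V H → V H′
    image v = W′.from (proj₁ (found v))

    comp-image : ∀ v → comp (W′.e (image v)) ≡ toℕ (σ (W.compᶠ v))
    comp-image v = proj₁ (proj₂ (found v))

    pos-image : ∀ v → pos (W′.e (image v)) ≡ φ v
    pos-image v = proj₂ (proj₂ (found v))

    label-image : ∀ v → u (pos (W′.e (image v))) ≡ u (pos (W.e v))
    label-image v = trans (cong u (pos-image v))
      (trans (Row.φ-label (W.compᶠ v) {W.posᶠ v} (W.occupied v)) (cong u (W.toℕ-posᶠ v)))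

    module _ (v w : V H) where

      compᶠ-≡ : comp (W.e v) ≡ comp (W.e w) → W.compᶠ v ≡ W.compᶠ w
      compᶠ-≡ eq = toℕ-injective (trans (W.toℕ-compᶠ v) (trans eq (≡-sym (W.toℕ-compᶠ w))))

      compᶠ-image : comp (W′.e (image v)) ≡ comp (W′.e (image w)) → W.compᶠ v ≡ W.compᶠ w
      compᶠ-image eq = σ-injective (toℕ-injective (trans (≡-sym (comp-image v)) (trans eq (comp-image w))))

      comp-to : comp (W.e v) ≡ comp (W.e w) → comp (W′.e (image v)) ≡ comp (W′.e (image w))
      comp-to eq = trans (comp-image v) (trans (cong (toℕ ∘ σ) (compᶠ-≡ eq)) (≡-sym (comp-image w)))

      comp-from : comp (W′.e (image v)) ≡ comp (W′.e (image w)) → comp (W.e v) ≡ comp (W.e w)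
      comp-from eq = trans (≡-sym (W.toℕ-compᶠ v)) (trans (cong toℕ (compᶠ-image eq)) (W.toℕ-compᶠ w))

    in-row : (v w : V H) → W.compᶠ v ≡ W.compᶠ w →
      (φ v ≡ φ w → toℕ (W.posᶠ v) ≡ toℕ (W.posᶠ w)) ×
      (suc (toℕ (W.posᶠ v)) ≡ toℕ (W.posᶠ w) → suc (φ v) ≡ φ w) ×
      (suc (φ v) ≡ φ w → suc (toℕ (W.posᶠ v)) ≡ toℕ (W.posᶠ w))
    in-row v w eq = row (W.compᶠ w) eq (W.occupied w)
      where
      -- The row of `w` is generalised to `c`, so that matching on the equation puts both vertices
      -- in the same row.
      row : ∀ c → W.compᶠ v ≡ c → W.Occupied (toℕ c) (toℕ (W.posᶠ w)) →
        (φ v ≡ Row.φ c (W.posᶠ w) → toℕ (W.posᶠ v) ≡ toℕ (W.posᶠ w)) ×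
        (suc (toℕ (W.posᶠ v)) ≡ toℕ (W.posᶠ w) → suc (φ v) ≡ Row.φ c (W.posᶠ w)) ×
        (suc (φ v) ≡ Row.φ c (W.posᶠ w) → suc (toℕ (W.posᶠ v)) ≡ toℕ (W.posᶠ w))
      row c refl t = Row.φ-injective c {W.posᶠ v} {W.posᶠ w} (W.occupied v) t
                   , Row.φ-suc c {W.posᶠ v} {W.posᶠ w} (W.occupied v) t
                   , Row.φ-suc⁻¹ c {W.posᶠ v} {W.posᶠ w} (W.occupied v) t

    suc-to : ∀ v w → comp (W.e v) ≡ comp (W.e w) →
      suc (pos (W.e v)) ≡ pos (W.e w) → suc (pos (W′.e (image v))) ≡ pos (W′.e (image w))
    suc-to v w c eq = subst₂ (λ x y → suc x ≡ y) (≡-sym (pos-image v)) (≡-sym (pos-image w))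
      (proj₁ (proj₂ (in-row v w (compᶠ-≡ v w c)))
        (subst₂ (λ x y → suc x ≡ y) (≡-sym (W.toℕ-posᶠ v)) (≡-sym (W.toℕ-posᶠ w)) eq))

    suc-from : ∀ v w → comp (W.e v) ≡ comp (W.e w) →
      suc (pos (W′.e (image v))) ≡ pos (W′.e (image w)) → suc (pos (W.e v)) ≡ pos (W.e w)
    suc-from v w c eq = subst₂ (λ x y → suc x ≡ y) (W.toℕ-posᶠ v) (W.toℕ-posᶠ w)
      (proj₂ (proj₂ (in-row v w (compᶠ-≡ v w c)))
        (subst₂ (λ x y → suc x ≡ y) (pos-image v) (pos-image w) eq))

    injective : ∀ v w → image v ≡ image w → v ≡ w
    injective v w eq = proj₁ (proj₂ (proj₂ h)) v w (vertex-≡ c p)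
      where
      c : comp (W.e v) ≡ comp (W.e w)
      c = comp-from v w (cong (comp ∘ W′.e) eq)
      p : pos (W.e v) ≡ pos (W.e w)
      p = trans (≡-sym (W.toℕ-posᶠ v)) (trans
        (proj₁ (in-row v w (compᶠ-≡ v w c))
          (trans (≡-sym (pos-image v)) (trans (cong (pos ∘ W′.e) eq) (pos-image w))))
        (W.toℕ-posᶠ w))

    edges : ∀ v w → (E H v w → E H′ (image v) (image w)) × (E H′ (image v) (image w) → E H v w)
    edges v w = (λ a → proj₂ (edge′ (image v) (image w)) (proj₁ transfer (proj₁ (edge v w) a)))
              , (λ a → proj₂ (edge v w) (proj₂ transfer (proj₁ (edge′ (image v) (image w)) a)))
      where
      edge  = proj₂ (proj₂ (proj₂ h))
      edge′ = proj₂ (proj₂ (proj₂ h′))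
      transfer = Adj-transfer {W.e v} {W.e w} {W′.e (image v)} {W′.e (image w)}
        (label-image v) (label-image w) (comp-to v w) (comp-from v w)
        (λ c → ⊎-map (suc-to v w c) (suc-to w v (≡-sym c)))
        (λ c → ⊎-map (suc-from v w c) (suc-from w v (≡-sym c)))

  ageWQO : AgeWQO graph
  ageWQO (s , inAge , antichain)
    with AF-good (higman (sublist? _⊑?_) (higman _⊑?_ AF-⊑)) (λ i → Word.word {s i} (inAge i))
  ... | i , j , i<j , emb =
    antichain i j (<⇒≢ i<j) (word-embedding {s i} {s j} (inAge i) (inAge j) emb)

-- The family indexed by the Cantor space

true∷_ : (ℕ → Bool) → ℕ → Bool
(true∷ x) zero    = true
(true∷ x) (suc n) = x n

-- The leading `true` becomes the value at 0, so all even positions of the Toeplitz word are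
-- labelled true.
sequence : (ℕ → Bool) → ℕ → Bool
sequence x = code (true∷ x)

sequence-noTriple : ∀ x → NoTriple (sequence x)
sequence-noTriple x = code-noTriple (true∷ x)

sequence-reads : ∀ x n → sequence x (suc n + suc n) ≡ x n
sequence-reads x n = code-even (true∷ x) (suc n)

word : (ℕ → Bool) → ℕ → Bool
word x = toeplitz (sequence x)

incomparable : ∀ x y → Distinct x y → ¬ AgeSub (Adjacency.graph (word x)) (Adjacency.graph (word y))
incomparable x y x≢y sub = x≢y λ n → trans (≡-sym (sequence-reads x n))
  -- Bit `n` of `x` sits at index `suc n + suc n`, behind the leading `true` and its complement.
  (trans (ageSub⇒≡ sub (suc n + suc n)) (sequence-reads y n))
  where open Incomparability {sequence x} {sequence y} (sequence-noTriple x) refl refl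

theorem1 : Σ ((ℕ → Bool) → Graph) λ F →
    (∀ x → PathMinimal (F x)) ×
    (∀ x → AgeWQO (F x)) ×
    (∀ x y → Distinct x y → ¬ AgeSub (F x) (F y) × ¬ AgeSub (F y) (F x))
theorem1 = (λ x → Adjacency.graph (word x))
  , (λ x → Minimality.pathMinimal (word x) (toeplitz-even (sequence x)) (toeplitz-recurrent (sequence x)))
  , (λ x → Quasiorder.ageWQO (word x) (toeplitz-recurrent (sequence x)))
  , λ x y x≢y → incomparable x y x≢y , incomparable y x (λ y≡x → x≢y λ n → ≡-sym (y≡x n))
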